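{- For every word $w$ over a finite alphabet and every set $P$ of positions on $w$, $P$ is a word attractor of $w$ if and only if the algorithm $\mathrm{IsAttractor}(w,P)$ returns $\mathrm{True}$.
   Context: Let $w=w_1w_2\cdots w_n$ be a finite word over a finite alphabet, $|w|=n$. Positions on $w$ are the elements of $\{1,\dots,n\}$, and a set of positions is a subset $P\subseteq\{1,\dots,n\}$. A factor of $w$ is a word $w_{[i,j]}=w_i\cdots w_j$ (the empty word if $j<i$). An occurrence of a non-empty factor $u$ in $w$ is a pair $(i,j)$, $1\le i\le j\le n$, with $u=w_{[i,j]}$; $j$ is its ending position. A non-empty factor $u$ covers $P$ if there is an occurrence $(i,j)$ of $u$ in $w$ and $t\in P$ with $i\le t\le j$. $P$ is a word attractor of $w$ if every non-empty factor of $w$ covers $P$. Suffix automaton (DAWG): the states of $\mathcal{S}(w)$ are the equivalence classes of the factors of $w$ (including the empty word), where two factors are equivalent iff they have the same set of ending positions in $w$ (the empty word having ending positions $0,1,\dots,n$). The initial state $I$ is the class of the empty word. For a factor $u$, $\delta(I,u)$ is the class of $u$. For a state $q$, $\ell[q]$ is the minimum length of the factors in $q$. Suffix links: for a state $q\neq I$ and any factor $x\in q$, $F[q]$ is the class of the longest suffix of $x$ that does not belong to $q$ (independent of the choice of $x$). The map $F$, viewed as a parent map, makes the set of states a tree $\mathcal{T}$ rooted at $I$. The table of prefix states is $T[j]=\delta(I,w_{[1,j]})$ for $1\le j\le n$. Algorithm $\mathrm{IsAttractor}(w,P)$: 1. For each state $q$ of $\mathcal{S}(w)$ set $d[q]\leftarrow+\infty$.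 2. Set $k\leftarrow-\infty$. For $j=1,2,\dots,|w|$ in this order: if $j\in P$ then set $k\leftarrow j$; then set $d[T[j]]\leftarrow j-k$ (which is $+\infty$ if $k=-\infty$). 3. For each node $q\neq I$ in a bottom-up traversal of $\mathcal{T}$ (children before parents): set $d[q]\leftarrow\min(\{d[q]\}\cup\{d[r]\mid F[r]=q\})$; if $d[q]\ge\ell[q]$, return $\mathrm{False}$ (and stop). 4. Return $\mathrm{True}$. -}

module Defs where

open import Data.Bool.Base using (Bool; true; false; if_then_else_)
import Data.Bool.Properties as Bool
open import Data.Empty using (⊥-elim)
open import Data.Fin.Base using (Fin; toℕ)
import Data.Fin.Properties as Fin
open import Data.Fin.Subset using (Subset; ∣_∣; _⊆_; _⊂_) renaming (_∈_ to _∈ˢ_)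
open import Data.Fin.Subset.Properties
  using (⊆-antisym; p⊂q⇒∣p∣<∣q∣) renaming (_∈?_ to _∈ˢ?_)
open import Data.List.Base
  using (List; []; _∷_; length; map; foldr; foldl; filter; find; take; drop; tails;
         upTo; applyUpTo; allFin; cartesianProductWith; deduplicate)
open import Data.List.Extrema.Nat using (min)
import Data.List.Membership.DecPropositional as DecMembership
open import Data.List.Membership.Propositional using (_∈_; _∉_)
open import Data.List.Membership.Propositional.Properties
  using (∈-filter⁺; ∈-filter⁻; ∈-deduplicate⁺; ∈-deduplicate⁻; ∈-map⁻;
         ∈-cartesianProductWith⁺; ∈-cartesianProductWith⁻; ∈-applyUpTo⁺; ∈-applyUpTo⁻;
         ∈-upTo⁺; ∈-upTo⁻)
import Data.List.Properties as List
open import Data.List.Relation.Binary.Permutation.Propositional using (_↭_; ↭-sym)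
open import Data.List.Relation.Binary.Permutation.Propositional.Properties using (All-resp-↭)
open import Data.List.Relation.Unary.All as All using (All; []; _∷_)
open import Data.List.Relation.Unary.AllPairs as AllPairs using (AllPairs; []; _∷_)
open import Data.List.Relation.Unary.Any using (here; there)
import Data.List.Relation.Unary.Sorted.TotalOrder.Properties as SortedProperties
open import Data.List.Sort using (sort; sort-↭; sort-↗)
open import Data.Maybe.Base using (fromMaybe)
open import Data.Nat.Base
  using (ℕ; zero; suc; _∸_; _⊓_; _≤_; _<_; z≤n; s≤s)
open import Data.Nat.Properties as ℕ using (_≤?_; anyUpTo?)
open import Data.Product.Base using (∃; ∃₂; ∃-syntax; _×_; _,_; proj₁; proj₂)
import Data.Vec.Base as Vec
import Data.Vec.Properties as Vec
open import Relation.Binary.Bundles using (DecTotalOrder)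
import Relation.Binary.Construct.Add.Supremum.NonStrict as AddSupremum
import Relation.Binary.Construct.On as On
open import Relation.Binary.Definitions using (DecidableEquality)
open import Relation.Binary.PropositionalEquality
  using (_≡_; _≢_; refl; sym; trans; cong; subst)
open import Relation.Nullary.Construct.Add.Infimum using (_₋; ⊥₋)
open import Relation.Nullary.Construct.Add.Supremum using (_⁺; ⊤⁺; [_])
open import Relation.Nullary.Decidable
  using (Dec; yes; no; does; map′; _×-dec_; ¬?; dec-true; decidable-stable)
open import Relation.Nullary.Negation using (¬_)
open import Relation.Unary using (Decidable)

------------------------------------------------------------------------
-- Words and attractors

Word : ℕ → Set
Word σ = List (Fin σ)

-- Positions are 1-based: w ⟦ i , j ⟧ = w_i ⋯ w_j for 1 ≤ i and j ≤ |w|, and [] if j < i.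
infix 30 _⟦_,_⟧
_⟦_,_⟧ : ∀ {σ} → Word σ → ℕ → ℕ → Word σ
w ⟦ i , j ⟧ = take (suc j ∸ i) (drop (i ∸ 1) w)

-- The 1-based position represented by an index.
pos : ∀ {n} → Fin n → ℕ
pos p = suc (toℕ p)

module _ {σ : ℕ} (w : Word σ) where

  IsFactor : Word σ → Set
  IsFactor u = ∃₂ λ i j → 1 ≤ i × j ≤ length w × u ≡ w ⟦ i , j ⟧

  Occurrence : Word σ → ℕ → ℕ → Set
  Occurrence u i j = 1 ≤ i × i ≤ j × j ≤ length w × u ≡ w ⟦ i , j ⟧

  Covers : Word σ → Subset (length w) → Set
  Covers u P = ∃₂ λ i j → Occurrence u i j × (∃[ t ] t ∈ˢ P × i ≤ pos t × pos t ≤ j)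

  IsWordAttractor : Subset (length w) → Set
  IsWordAttractor P = ∀ u → IsFactor u → u ≢ [] → Covers u P

------------------------------------------------------------------------
-- The suffix automaton

infix 4 _≟ʷ_
_≟ʷ_ : ∀ {σ} → DecidableEquality (Word σ)
_≟ʷ_ = List.≡-dec Fin._≟_

-- An equivalence class of factors of w is represented by the list of its
-- elements, without repetition and in the order in which they occur in
-- `factors w`, so that equality of classes is propositional equality.
State : ℕ → Set
State σ = List (Word σ)

infix 4 _≟ˢ_
_≟ˢ_ : ∀ {σ} → DecidableEquality (State σ)
_≟ˢ_ = List.≡-dec _≟ʷ_

module _ {σ : ℕ} where
  open DecMembership (_≟ʷ_ {σ}) public using () renaming (_∈?_ to _∈ʷ?_)

-- Minimum length of the elements of a class (classes are non-empty).
ℓ : ∀ {σ} → State σ → ℕ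
ℓ []      = 0
ℓ (x ∷ q) = min (length x) (map length q)

module _ {σ : ℕ} (w : Word σ) where

  EndsAt : Word σ → ℕ → Set
  EndsAt []        j = j ≤ length w
  EndsAt u@(_ ∷ _) j = ∃[ i ] Occurrence w u i j

  endsAt? : ∀ u → Decidable (EndsAt u)
  endsAt? []        j = j ≤? length w
  endsAt? u@(_ ∷ _) j =
    map′ (λ (i , _ , o) → i , o) (λ (i , o) → i , s≤s (proj₁ (proj₂ o)) , o)
      (anyUpTo? (λ i → (1 ≤? i) ×-dec (i ≤? j) ×-dec (j ≤? length w) ×-dec (u ≟ʷ w ⟦ i , j ⟧)) (suc j))

  -- The set of ending positions, as a subset of {0, …, |w|}.
  endpos : Word σ → Subset (suc (length w))
  endpos u = Vec.tabulate (λ j → does (endsAt? u (toℕ j)))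

  _∼_ : Word σ → Word σ → Set
  u ∼ v = endpos u ≡ endpos v

  _∼?_ : ∀ u v → Dec (u ∼ v)
  u ∼? v = Vec.≡-dec Bool._≟_ (endpos u) (endpos v)

  -- All w ⟦ i , j ⟧ with 1 ≤ i ≤ |w| + 1 and 0 ≤ j ≤ |w|, each listed once.
  factors : List (Word σ)
  factors = deduplicate _≟ʷ_
    (cartesianProductWith (w ⟦_,_⟧) (applyUpTo suc (suc (length w))) (upTo (suc (length w))))

  class : Word σ → State σ
  class u = filter (u ∼?_) factors

  states : List (State σ)
  states = deduplicate _≟ˢ_ (map class factors)

  I : State σ
  I = class []

  nonInitialStates : List (State σ)
  nonInitialStates = filter (λ q → ¬? (q ≟ˢ I)) states

  -- `tails x` lists the suffixes of x by decreasing length. For q ≢ I the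
  -- empty word is not in q, so the default value of `fromMaybe` is never used.
  longestSuffixOutside : State σ → Word σ → Word σ
  longestSuffixOutside q x = fromMaybe [] (find (λ s → ¬? (s ∈ʷ? q)) (tails x))

  -- Suffix link, computed from the first element of the class. The values
  -- on I and on lists that are not states are irrelevant.
  F : State σ → State σ
  F []        = I
  F q@(x ∷ _) = class (longestSuffixOutside q x)

  T : ℕ → State σ
  T j = class (w ⟦ 1 , j ⟧)

  children : State σ → List (State σ)
  children q = filter (λ r → F r ≟ˢ q) nonInitialStates

  -- Every state other than I is visited exactly once, and no state is
  -- visited before one of its children.
  IsBottomUpTraversal : List (State σ) → Set
  IsBottomUpTraversal qs = qs ↭ nonInitialStates × AllPairs (λ q r → F r ≢ q) qs

------------------------------------------------------------------------
-- The algorithm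

ℕ∞ : Set
ℕ∞ = ℕ ⁺

open AddSupremum _≤_ public using (_≤⁺_; ≤⁺-dec)

_⊓∞_ : ℕ∞ → ℕ∞ → ℕ∞
⊤⁺    ⊓∞ b     = b
a     ⊓∞ ⊤⁺    = a
[ a ] ⊓∞ [ b ] = [ a ⊓ b ]

-- j - k for k ∈ ℕ ∪ {-∞}; truncated subtraction is only used with k ≤ j.
_⊖_ : ℕ → ℕ ₋ → ℕ∞
j ⊖ ⊥₋    = ⊤⁺
j ⊖ [ k ] = [ j ∸ k ]

Table : ℕ → Set
Table σ = State σ → ℕ∞

infixl 20 _⟦_≔_⟧
_⟦_≔_⟧ : ∀ {σ} → Table σ → State σ → ℕ∞ → Table σ
(d ⟦ q ≔ v ⟧) r = if does (r ≟ˢ q) then v else d r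

module _ {σ : ℕ} (w : Word σ) where

  initialTable : Table σ
  initialTable _ = ⊤⁺

  lastPosition : Subset (length w) → ℕ ₋ → Fin (length w) → ℕ ₋
  lastPosition P k p = if does (p ∈ˢ? P) then [ pos p ] else k

  scanStep : Subset (length w) → ℕ ₋ × Table σ → Fin (length w) → ℕ ₋ × Table σ
  scanStep P (k , d) p =
    let k′ = lastPosition P k p in k′ , d ⟦ T w (pos p) ≔ pos p ⊖ k′ ⟧

  scan : Subset (length w) → Table σ
  scan P = proj₂ (foldl (scanStep P) (⊥₋ , initialTable) (allFin (length w)))

  minOverChildren : Table σ → State σ → ℕ∞
  minOverChildren d q = foldr _⊓∞_ (d q) (map d (children w q))

  traverse : List (State σ) → Table σ → Bool
  traverse []       d = true
  traverse (q ∷ qs) d =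
    let v = minOverChildren d q in
    if does (≤⁺-dec _≤?_ [ ℓ q ] v) then false else traverse qs (d ⟦ q ≔ v ⟧)

  -- The algorithm run on P, with the states visited in the order qs.
  isAttractor : Subset (length w) → List (State σ) → Bool
  isAttractor P qs = traverse qs (scan P)

------------------------------------------------------------------------
-- A bottom-up traversal exists: visit the states by increasing number of
-- ending positions.

module _ {σ : ℕ} (w : Word σ) where

  take≢[] : ∀ {A : Set} {a : A} {x} m (ys : List A) → a ∷ x ≡ take m ys → m ≢ 0
  take≢[] (suc m) ys eq ()

  take-drop-tail : ∀ {A : Set} {a : A} {x} j i (ys : List A) →
    a ∷ x ≡ take (j ∸ i) (drop i ys) → x ≡ take (j ∸ suc i) (drop (suc i) ys)
  take-drop-tail (suc j) zero    (y ∷ ys) refl = refl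
  take-drop-tail (suc j) (suc i) (y ∷ ys) eq   = take-drop-tail j i ys eq
  take-drop-tail zero    (suc i) ys       ()
  take-drop-tail (suc j) (suc i) []       eq with () ← trans eq (List.take-[] (j ∸ i))

  EndsAt-tail : ∀ a x {j} → EndsAt w (a ∷ x) j → EndsAt w x j
  EndsAt-tail a []      (i , _ , _ , j≤n , _) = j≤n
  EndsAt-tail a (b ∷ x) {j} (suc i , _ , i<j , j≤n , eq) =
    suc (suc i) , s≤s z≤n , i+2≤j , j≤n , eq′
    where
    eq′ : b ∷ x ≡ w ⟦ suc (suc i) , j ⟧
    eq′ = take-drop-tail j i w eq
    i+2≤j : suc (suc i) ≤ j
    i+2≤j = ℕ.m∸n≢0⇒n<m (take≢[] (j ∸ suc i) (drop (suc i) w) eq′)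

  EndsAt-tails : ∀ x → All (λ s → ∀ j → EndsAt w x j → EndsAt w s j) (tails x)
  EndsAt-tails []      = (λ _ e → e) ∷ []
  EndsAt-tails (a ∷ x) =
    (λ _ e → e) ∷ All.map (λ f j e → f j (EndsAt-tail a x e)) (EndsAt-tails x)

  EndsAt-bound : ∀ x {j} → EndsAt w x j → j ≤ length w
  EndsAt-bound []      j≤n                     = j≤n
  EndsAt-bound (_ ∷ _) (_ , _ , _ , j≤n , _) = j≤n

  ∈-endpos⁺ : ∀ u {j} → EndsAt w u (toℕ j) → j ∈ˢ endpos w u
  ∈-endpos⁺ u {j} e = Vec.lookup⇒[]= j _
    (trans (Vec.lookup∘tabulate (λ j → does (endsAt? w u (toℕ j))) j) (dec-true (endsAt? w u (toℕ j)) e))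

  ∈-endpos⁻ : ∀ u {j} → j ∈ˢ endpos w u → EndsAt w u (toℕ j)
  ∈-endpos⁻ u {j} j∈ with endsAt? w u (toℕ j)
                        | trans (sym (Vec.lookup∘tabulate (λ j → does (endsAt? w u (toℕ j))) j))
                                (Vec.[]=⇒lookup j∈)
  ... | yes e | _ = e

  ∈-factors⁺ : ∀ {i j} → 1 ≤ i → i ≤ suc (length w) → j ≤ length w → w ⟦ i , j ⟧ ∈ factors w
  ∈-factors⁺ {suc i} _ i≤ j≤ = ∈-deduplicate⁺ _≟ʷ_
    (∈-cartesianProductWith⁺ (w ⟦_,_⟧) (∈-applyUpTo⁺ suc i≤) (∈-upTo⁺ (s≤s j≤)))

  EndsAt⇒∈-factors : ∀ u {j} → EndsAt w u j → u ∈ factors w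
  EndsAt⇒∈-factors []      _ = ∈-factors⁺ {1} {0} ℕ.≤-refl (s≤s z≤n) z≤n
  EndsAt⇒∈-factors (_ ∷ _) (i , 1≤i , i≤j , j≤n , eq) =
    subst (_∈ factors w) (sym eq) (∈-factors⁺ 1≤i (ℕ.m≤n⇒m≤1+n (ℕ.≤-trans i≤j j≤n)) j≤n)

  ∈-factors⇒EndsAt : ∀ {u} → u ∈ factors w → ∃ (EndsAt w u)
  ∈-factors⇒EndsAt {[]}    _  = 0 , z≤n
  ∈-factors⇒EndsAt {_ ∷ _} u∈
    with i , j , i∈ , j∈ , eq ← ∈-cartesianProductWith⁻ (w ⟦_,_⟧) (applyUpTo suc (suc (length w)))
           (upTo (suc (length w))) (∈-deduplicate⁻ _≟ʷ_ _ u∈)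
    with i′ , _ , refl ← ∈-applyUpTo⁻ suc i∈
    = j , suc i′ , s≤s z≤n , ℕ.m∸n≢0⇒n<m (take≢[] (j ∸ i′) (drop i′ w) eq)
        , ℕ.≤-pred (∈-upTo⁻ j∈) , eq

  ⊆∧≢⇒⊂ : ∀ {n} {p q : Subset n} → p ⊆ q → p ≢ q → p ⊂ q
  ⊆∧≢⇒⊂ {p = p} {q} p⊆q p≢q with Fin.any? (λ x → (x ∈ˢ? q) ×-dec ¬? (x ∈ˢ? p))
  ... | yes (x , x∈q , x∉p) = p⊆q , x , x∈q , x∉p
  ... | no  ¬∃              = ⊥-elim (p≢q (⊆-antisym p⊆q
    λ {x} x∈q → decidable-stable (x ∈ˢ? p) λ x∉p → ¬∃ (x , x∈q , x∉p)))

  size : State σ → ℕ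
  size []      = 0
  size (x ∷ _) = ∣ endpos w x ∣

  ∈-class⁺ : ∀ u {v} → v ∈ factors w → _∼_ w u v → v ∈ class w u
  ∈-class⁺ u = ∈-filter⁺ (_∼?_ w u)

  ∈-class⁻ : ∀ u {v} → v ∈ class w u → v ∈ factors w × _∼_ w u v
  ∈-class⁻ u = ∈-filter⁻ (_∼?_ w u) {xs = factors w}

  size-class : ∀ {u} → u ∈ factors w → size (class w u) ≡ ∣ endpos w u ∣
  size-class {u} u∈ with class w u in eq | ∈-class⁺ u u∈ refl
  ... | x ∷ _ | _ = cong ∣_∣ (sym (proj₂ (∈-class⁻ u (subst (x ∈_) (sym eq) (here refl)))))

  longestSuffixOutside-elim : ∀ (P : Word σ → Set) q x →
    All (λ s → s ∉ q → P s) (tails x) → P [] → P (longestSuffixOutside w q x)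
  longestSuffixOutside-elim P q x = go (tails x)
    where
    go : ∀ ss → All (λ s → s ∉ q → P s) ss → P [] → P (fromMaybe [] (find (λ s → ¬? (s ∈ʷ? q)) ss))
    go []       []       P[] = P[]
    go (s ∷ ss) (f ∷ fs) P[] with s ∈ʷ? q
    ... | no s∉q = f s∉q
    ... | yes _   = go ss fs P[]

  size-F : ∀ {q} → q ∈ nonInitialStates w → size q < size (F w q)
  size-F {q} q∈
    with q∈states , q≢I ← ∈-filter⁻ (λ q → ¬? (q ≟ˢ I w)) {xs = states w} q∈
    with u , u∈ , q≡ ← ∈-map⁻ (class w) (∈-deduplicate⁻ _≟ˢ_ (map (class w) (factors w)) q∈states)
    = from-class q u u∈ q≡ q≢I
    where
    from-class : ∀ q u → u ∈ factors w → q ≡ class w u → q ≢ I w → size q < size (F w q)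
    from-class [] u u∈ q≡ _ with () ← subst (u ∈_) (sym q≡) (∈-class⁺ u u∈ refl)
    from-class q@(x ∷ _) u u∈ q≡ q≢I =
      subst (size q <_) (sym (size-class (proj₁ larger))) (proj₂ larger)
      where
      Larger : Word σ → Set
      Larger s = s ∈ factors w × ∣ endpos w x ∣ < ∣ endpos w s ∣

      x∈ : x ∈ factors w × _∼_ w u x
      x∈ = ∈-class⁻ u (subst (x ∈_) q≡ (here refl))

      larger⁺ : ∀ s → (∀ j → EndsAt w x j → EndsAt w s j) → ¬ (_∼_ w x s) → Larger s
      larger⁺ s f x≁s
        = EndsAt⇒∈-factors s (f _ (proj₂ (∈-factors⇒EndsAt (proj₁ x∈))))
        , p⊂q⇒∣p∣<∣q∣ (⊆∧≢⇒⊂ (λ j∈ → ∈-endpos⁺ s (f _ (∈-endpos⁻ x j∈))) x≁s)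

      outside : ∀ s → (∀ j → EndsAt w x j → EndsAt w s j) → s ∉ q → Larger s
      outside s f s∉q = larger⁺ s f λ x∼s →
        s∉q (subst (s ∈_) (sym q≡) (∈-class⁺ u
          (EndsAt⇒∈-factors s (f _ (proj₂ (∈-factors⇒EndsAt (proj₁ x∈)))))
          (trans (proj₂ x∈) x∼s)))

      x≁[] : ¬ (_∼_ w x [])
      x≁[] x∼[] = q≢I (trans q≡ (List.filter-≐ (_∼?_ w u) (_∼?_ w [])
        ( (λ u∼v → trans (sym u∼[]) u∼v) , (λ []∼v → trans u∼[] []∼v)) (factors w)))
        where u∼[] = trans (proj₂ x∈) x∼[]

      larger : Larger (longestSuffixOutside w q x)
      larger = longestSuffixOutside-elim Larger q x
        (All.map (λ {s} f → outside s f) (EndsAt-tails x))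
        (larger⁺ [] (λ _ → EndsAt-bound x) x≁[])

  bySize : DecTotalOrder _ _ _
  bySize = On.decTotalOrder ℕ.≤-decTotalOrder size

  childrenFirst : ∀ {qs} → All (λ q → size q < size (F w q)) qs →
    AllPairs (λ q r → size q ≤ size r) qs → AllPairs (λ q r → F w r ≢ q) qs
  childrenFirst []       []       = []
  childrenFirst (_ ∷ ps) (h ∷ hs) =
    All.map (λ (q≤r , r<Fr) Fr≡q → ℕ.<⇒≱ r<Fr (subst (λ q → size q ≤ _) (sym Fr≡q) q≤r))
      (All.zip (h , ps))
    ∷ childrenFirst ps hs

  bottomUpTraversal : ∃ (IsBottomUpTraversal w)
  bottomUpTraversal = sort bySize (nonInitialStates w) , sorted-↭ , childrenFirst
    (All-resp-↭ (↭-sym sorted-↭) (All.tabulate size-F))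
    (SortedProperties.Sorted⇒AllPairs (DecTotalOrder.totalOrder bySize)
      (sort-↗ bySize (nonInitialStates w)))
    where
    sorted-↭ : sort bySize (nonInitialStates w) ↭ nonInitialStates w
    sorted-↭ = sort-↭ bySize (nonInitialStates w)

{-# OPTIONS --safe #-}
module Submission where

-- A factor u ending at j contains a position of P in that occurrence iff the
-- distance from j back to the last position of P is less than |u|. So u covers
-- P iff the minimum of these distances over the ending positions of u is less
-- than |u|; the minimum depends only on the state of u, and the shortest
-- factors of a state are the hardest to cover. The ending positions of a state
-- q are those of its children together with j if q = T[j]: extend a factor of q
-- ending at j to the left until it leaves q or becomes the prefix w_1 ⋯ w_j; in
-- the former case the class entered has suffix link q. Hence the bottom-up
-- minima are the minima over ending positions.

open import Defs
open import Data.Bool.Base using (true)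
open import Data.Empty using (⊥; ⊥-elim)
open import Data.Fin.Base using (Fin; zero; suc; toℕ; fromℕ<)
import Data.Fin.Properties as Fin
open import Data.Fin.Subset using (Subset) renaming (_∈_ to _∈ˢ_)
open import Data.Fin.Subset.Properties using (⊆-antisym) renaming (_∈?_ to _∈ˢ?_)
open import Data.List.Base
  using (List; []; _∷_; length; map; foldr; foldl; take; drop; tabulate)
open import Data.List.Membership.Propositional using (_∈_; _∉_; find; lose)
open import Data.List.Membership.Propositional.Properties
  using (∈-filter⁺; ∈-filter⁻; ∈-deduplicate⁺; ∈-deduplicate⁻; ∈-map⁺; ∈-map⁻)
import Data.List.Properties as List
open import Data.List.Extrema.Nat using (min≤v⁺; argmin-sel)
open import Data.List.Relation.Binary.Permutation.Propositional using (↭-sym)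
open import Data.List.Relation.Binary.Permutation.Propositional.Properties using (∈-resp-↭)
open import Data.List.Relation.Unary.All as All using (All; []; _∷_)
open import Data.List.Relation.Unary.AllPairs using (AllPairs; []; _∷_)
open import Data.List.Relation.Unary.Any using (Any; here; there)
import Data.List.Relation.Unary.Any.Properties as Any
open import Data.Nat.Base
  using (ℕ; zero; suc; _+_; _∸_; _⊓_; _≤_; _<_; _≤‴_; ≤‴-refl; ≤‴-step; z≤n; s≤s)
open import Data.Nat.Properties as ℕ using (_≤?_)
open import Data.Product.Base using (Σ-syntax; ∃-syntax; _×_; _,_; proj₁; proj₂)
open import Data.Sum.Base as Sum using (_⊎_; inj₁; inj₂; [_,_]′)
open import Function.Base using (_∘_; id)
open import Function.Bundles using (_⇔_; mk⇔; Equivalence)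
open import Relation.Binary.PropositionalEquality
  using (_≡_; _≢_; refl; sym; trans; cong; subst; module ≡-Reasoning)
open import Relation.Nullary.Construct.Add.Infimum using (_₋)
open import Relation.Nullary.Construct.Add.Supremum using (⊤⁺; [_])
open import Relation.Nullary.Decidable using (Dec; yes; no; dec-true; dec-false; ¬?)
open import Relation.Nullary.Negation using (¬_)
import Relation.Binary.Construct.Add.Supremum.NonStrict as AddSupremum

open Equivalence using (to; from)

-- Extended distances compared with finite bounds.

infix 4 _≺_
-- Table entries are only ever described through the bounds `L` they lie below; with `L = ℓ q` this
-- is the negation of the test made by the algorithm.
_≺_ : ℕ∞ → ℕ → Set
⊤⁺    ≺ L = ⊥
[ a ] ≺ L = a < L

⊓∞-≺⁺ : ∀ a b {L} → a ≺ L ⊎ b ≺ L → a ⊓∞ b ≺ L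
⊓∞-≺⁺ ⊤⁺    b     (inj₂ b<L) = b<L
⊓∞-≺⁺ [ a ] ⊤⁺    (inj₁ a<L) = a<L
⊓∞-≺⁺ [ a ] [ b ] (inj₁ a<L) = ℕ.m<n⇒m⊓o<n b a<L
⊓∞-≺⁺ [ a ] [ b ] (inj₂ b<L) = ℕ.m<n⇒o⊓m<n a b<L

⊓∞-≺⁻ : ∀ a b {L} → a ⊓∞ b ≺ L → a ≺ L ⊎ b ≺ L
⊓∞-≺⁻ ⊤⁺    b     h = inj₂ h
⊓∞-≺⁻ [ a ] ⊤⁺    h = inj₁ h
⊓∞-≺⁻ [ a ] [ b ] h with ℕ.⊓-sel a b
... | inj₁ eq = inj₁ (subst (_< _) eq h)
... | inj₂ eq = inj₂ (subst (_< _) eq h)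

foldr-⊓∞-≺⁺ : ∀ a bs {L} → a ≺ L ⊎ Any (_≺ L) bs → foldr _⊓∞_ a bs ≺ L
foldr-⊓∞-≺⁺ a []       (inj₁ h)         = h
foldr-⊓∞-≺⁺ a (b ∷ bs) (inj₁ h)         = ⊓∞-≺⁺ b _ (inj₂ (foldr-⊓∞-≺⁺ a bs (inj₁ h)))
foldr-⊓∞-≺⁺ a (b ∷ bs) (inj₂ (here h))  = ⊓∞-≺⁺ b _ (inj₁ h)
foldr-⊓∞-≺⁺ a (b ∷ bs) (inj₂ (there h)) = ⊓∞-≺⁺ b _ (inj₂ (foldr-⊓∞-≺⁺ a bs (inj₂ h)))

foldr-⊓∞-≺⁻ : ∀ a bs {L} → foldr _⊓∞_ a bs ≺ L → a ≺ L ⊎ Any (_≺ L) bs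
foldr-⊓∞-≺⁻ a []       h = inj₁ h
foldr-⊓∞-≺⁻ a (b ∷ bs) h with ⊓∞-≺⁻ b _ h
... | inj₁ b≺L = inj₂ (here b≺L)
... | inj₂ h′  = Sum.map₂ there (foldr-⊓∞-≺⁻ a bs h′)

≰⁺⇒≺ : ∀ v {L} → ¬ ([ L ] ≤⁺ v) → v ≺ L
≰⁺⇒≺ ⊤⁺    L≰v = L≰v (_ AddSupremum.≤⊤⁺)
≰⁺⇒≺ [ a ] L≰v = ℕ.≰⇒> (L≰v ∘ AddSupremum.[_])

≺⇒≰⁺ : ∀ v {L} → v ≺ L → ¬ ([ L ] ≤⁺ v)
≺⇒≰⁺ [ a ] a<L AddSupremum.[ L≤a ] = ℕ.<⇒≱ a<L L≤a

-- Shortest members of a state.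

module _ {σ : ℕ} where

  ℓ-≤ : ∀ (q : State σ) {u} → u ∈ q → ℓ q ≤ length u
  ℓ-≤ (x ∷ q) (here refl) = min≤v⁺ (length x) (map length q) (inj₁ ℕ.≤-refl)
  ℓ-≤ (x ∷ q) (there u∈)  =
    min≤v⁺ (length x) (map length q) (inj₂ (lose (∈-map⁺ length u∈) ℕ.≤-refl))

  ℓ-attained : ∀ (q : State σ) {u} → u ∈ q → ∃[ v ] v ∈ q × length v ≡ ℓ q
  ℓ-attained (x ∷ q) _ with argmin-sel id (length x) (map length q)
  ... | inj₁ eq = x , here refl , sym eq
  ... | inj₂ m∈ with v , v∈ , eq ← ∈-map⁻ length m∈ = v , there v∈ , sym eq

-- Longest suffixes outside a state, and equivalence through ending positions.

module _ {σ : ℕ} (w : Word σ) where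

  longestSuffixOutside-∉ : ∀ q u → u ∉ q → longestSuffixOutside w q u ≡ u
  longestSuffixOutside-∉ q u u∉q rewrite dec-false (u ∈ʷ? q) u∉q = refl

  longestSuffixOutside-∈ : ∀ q a u → a ∷ u ∈ q →
    longestSuffixOutside w q (a ∷ u) ≡ longestSuffixOutside w q u
  longestSuffixOutside-∈ q a u au∈q rewrite dec-true ((a ∷ u) ∈ʷ? q) au∈q = refl

  -- `F` works with whichever member is listed first; only its membership in `q` is passed on, so
  -- later arguments must hold for every member.
  F-class : ∀ q {u} → u ∈ q → ∃[ x ] x ∈ q × F w q ≡ class w (longestSuffixOutside w q x)
  F-class (x ∷ q) _ = x , here refl , refl

  ∼⇒EndsAt : ∀ u v → _∼_ w u v → ∀ {j} → EndsAt w u j → EndsAt w v j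
  ∼⇒EndsAt u v u∼v {j} e = subst (EndsAt w v) toℕ-k
    (∈-endpos⁻ w v (subst (k ∈ˢ_) u∼v (∈-endpos⁺ w u (subst (EndsAt w u) (sym toℕ-k) e))))
    where
    j<1+n = s≤s (EndsAt-bound w u e)
    k = fromℕ< j<1+n
    toℕ-k : toℕ k ≡ j
    toℕ-k = Fin.toℕ-fromℕ< j<1+n

  EndsAt⇒∼ : ∀ u v → (∀ {j} → EndsAt w u j → EndsAt w v j) →
    (∀ {j} → EndsAt w v j → EndsAt w u j) → _∼_ w u v
  EndsAt⇒∼ u v u⇒v v⇒u = ⊆-antisym
    (λ j∈ → ∈-endpos⁺ w v (u⇒v (∈-endpos⁻ w u j∈)))
    (λ j∈ → ∈-endpos⁺ w u (v⇒u (∈-endpos⁻ w v j∈)))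

  class-cong : ∀ u v → _∼_ w u v → class w u ≡ class w v
  class-cong u v u∼v = List.filter-≐ (_∼?_ w u) (_∼?_ w v)
    ((λ u∼x → trans (sym u∼v) u∼x) , (λ v∼x → trans u∼v v∼x)) (factors w)

  class-injective : ∀ u v {j} → EndsAt w v j → class w u ≡ class w v → _∼_ w u v
  class-injective u v e eq =
    proj₂ (∈-class⁻ w u (subst (v ∈_) (sym eq) (∈-class⁺ w v (EndsAt⇒∈-factors w v e) refl)))

  -- Factors given by their endpoints.

  length-⟦⟧ : ∀ i {j} → j ≤ length w → length (w ⟦ suc i , j ⟧) ≡ j ∸ i
  length-⟦⟧ i {j} j≤n = begin
    length (take (j ∸ i) (drop i w))   ≡⟨ List.length-take (j ∸ i) (drop i w) ⟩
    (j ∸ i) ⊓ length (drop i w)        ≡⟨ cong ((j ∸ i) ⊓_) (List.length-drop i w) ⟩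
    (j ∸ i) ⊓ (length w ∸ i)           ≡⟨ ℕ.m≤n⇒m⊓n≡m (ℕ.∸-monoˡ-≤ i j≤n) ⟩
    j ∸ i                              ∎
    where open ≡-Reasoning

  ⟦⟧-∷ : ∀ {i j} → i < j → j ≤ length w → ∃[ a ] w ⟦ suc i , j ⟧ ≡ a ∷ w ⟦ suc (suc i) , j ⟧
  ⟦⟧-∷ {i} {j} i<j j≤n with w ⟦ suc i , j ⟧ in eq
  ... | a ∷ x = a , cong (a ∷_) (take-drop-tail w j i w (sym eq))
  ... | []    = ⊥-elim (ℕ.m>n⇒m∸n≢0 i<j (trans (sym (length-⟦⟧ i j≤n)) (cong length eq)))

  ⟦⟧-≢[] : ∀ {i j} → i < j → j ≤ length w → w ⟦ suc i , j ⟧ ≢ []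
  ⟦⟧-≢[] i<j j≤n eq with () ← trans (sym eq) (proj₂ (⟦⟧-∷ i<j j≤n))

  Occurrence⇒EndsAt : ∀ u {i j} → Occurrence w u i j → EndsAt w u j
  Occurrence⇒EndsAt []      (_ , _ , j≤n , _) = j≤n
  Occurrence⇒EndsAt (_ ∷ _) o                 = _ , o

  EndsAt⇒Occurrence : ∀ {u j} → u ≢ [] → EndsAt w u j → ∃[ i ] Occurrence w u i j
  EndsAt⇒Occurrence {[]}    u≢[] _ = ⊥-elim (u≢[] refl)
  EndsAt⇒Occurrence {_ ∷ _} _    e = e

  ⟦⟧-EndsAt : ∀ {i j} → i < j → j ≤ length w → EndsAt w (w ⟦ suc i , j ⟧) j
  ⟦⟧-EndsAt i<j j≤n = Occurrence⇒EndsAt _ (s≤s z≤n , i<j , j≤n , refl)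

  -- Dropping first letters keeps ending positions. The order `≤‴` recurses by raising its left end,
  -- as each dropped letter does; for `k = j` the suffix is empty.
  EndsAt-⟦⟧-mono : ∀ {i k j m} → i ≤‴ k → k ≤ j → j ≤ length w →
    EndsAt w (w ⟦ suc i , j ⟧) m → EndsAt w (w ⟦ suc k , j ⟧) m
  EndsAt-⟦⟧-mono ≤‴-refl         k≤j j≤n e = e
  EndsAt-⟦⟧-mono {m = m} (≤‴-step i<k) k≤j j≤n e
    with a , eq ← ⟦⟧-∷ (ℕ.<-≤-trans (ℕ.≤‴⇒≤ i<k) k≤j) j≤n =
    EndsAt-⟦⟧-mono i<k k≤j j≤n (EndsAt-tail w a _ (subst (λ u → EndsAt w u m) eq e))

  -- The search tries suffixes by increasing starting position, so it skips all those in `q` and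
  -- stops at the first one outside.
  longestSuffixOutside-⟦⟧ : ∀ q {i k j} → i ≤‴ k → k ≤ j → j ≤ length w →
    (∀ {m} → i ≤ m → m < k → w ⟦ suc m , j ⟧ ∈ q) → w ⟦ suc k , j ⟧ ∉ q →
    longestSuffixOutside w q (w ⟦ suc i , j ⟧) ≡ w ⟦ suc k , j ⟧
  longestSuffixOutside-⟦⟧ q ≤‴-refl _ _ _ k∉q = longestSuffixOutside-∉ q _ k∉q
  longestSuffixOutside-⟦⟧ q {i} {k} {j} (≤‴-step i<k) k≤j j≤n between k∉q
    with a , eq ← ⟦⟧-∷ (ℕ.<-≤-trans (ℕ.≤‴⇒≤ i<k) k≤j) j≤n = begin
    longestSuffixOutside w q (w ⟦ suc i , j ⟧)        ≡⟨ cong (longestSuffixOutside w q) eq ⟩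
    longestSuffixOutside w q (a ∷ w ⟦ suc (suc i) , j ⟧)
      ≡⟨ longestSuffixOutside-∈ q a _ (subst (_∈ q) eq (between ℕ.≤-refl (ℕ.≤‴⇒≤ i<k))) ⟩
    longestSuffixOutside w q (w ⟦ suc (suc i) , j ⟧)
      ≡⟨ longestSuffixOutside-⟦⟧ q i<k k≤j j≤n (λ i<m → between (ℕ.<⇒≤ i<m)) k∉q ⟩
    w ⟦ suc k , j ⟧                                   ∎
    where open ≡-Reasoning

  -- Suffix links of factors.

  -- The empty word ends at 0, whereas a non-empty word ends at 1 or later.
  ∼-≢[] : ∀ {u v} → _∼_ w u v → u ≢ [] → v ≢ []
  ∼-≢[] {u} u∼v u≢[] refl
    with _ , 1≤i , i≤0 , _ ← EndsAt⇒Occurrence u≢[] (∼⇒EndsAt [] u (sym u∼v) {0} z≤n) =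
    ℕ.<⇒≱ (ℕ.≤-trans 1≤i i≤0) z≤n

  -- Every word equivalent to y ends at j, hence is some w ⟦ suc k , j ⟧. If i < k
  -- it would be a suffix of x, and x a suffix of y, so that y ∼ x. Thus k ≤ i, and
  -- all suffixes of that word longer than x are squeezed between it and y.
  F-⟦⟧ : ∀ {i j} → i < j → j ≤ length w → ¬ (_∼_ w (w ⟦ suc i , j ⟧) (w ⟦ suc (suc i) , j ⟧)) →
    F w (class w (w ⟦ suc i , j ⟧)) ≡ class w (w ⟦ suc (suc i) , j ⟧)
  F-⟦⟧ {i} {j} i<j j≤n y≁x =
    let z , z∈ , Fq≡ = F-class (class w y)
                         (∈-class⁺ w y (EndsAt⇒∈-factors w y y-ends) refl)
        y∼z          = proj₂ (∈-class⁻ w y z∈)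
    in trans Fq≡ (cong (class w) (longestOutside y∼z
         (EndsAt⇒Occurrence (∼-≢[] y∼z (⟦⟧-≢[] i<j j≤n)) (∼⇒EndsAt y z y∼z y-ends))))
    where
    y x : Word σ
    y = w ⟦ suc i , j ⟧
    x = w ⟦ suc (suc i) , j ⟧
    y-ends : EndsAt w y j
    y-ends = ⟦⟧-EndsAt i<j j≤n
    x∉ : x ∉ class w y
    x∉ x∈ = y≁x (proj₂ (∈-class⁻ w y x∈))
    longestOutside : ∀ {z} → _∼_ w y z → (∃[ k ] Occurrence w z k j) →
      longestSuffixOutside w (class w y) z ≡ x
    longestOutside y∼z (suc k , _ , k<j , _ , refl) =
      longestSuffixOutside-⟦⟧ (class w y) (ℕ.≤⇒≤‴ (ℕ.m≤n⇒m≤1+n k≤i)) i<j j≤n between x∉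
      where
      k≤i : k ≤ i
      k≤i = ℕ.≮⇒≥ λ i<k → y≁x (EndsAt⇒∼ y x
        (EndsAt-⟦⟧-mono (≤‴-step ≤‴-refl) i<j j≤n)
        (λ e → ∼⇒EndsAt (w ⟦ suc k , j ⟧) y (sym y∼z)
          (EndsAt-⟦⟧-mono (ℕ.≤⇒≤‴ i<k) (ℕ.<⇒≤ k<j) j≤n e)))
      between : ∀ {m} → k ≤ m → m < suc i → w ⟦ suc m , j ⟧ ∈ class w y
      between {m} k≤m (s≤s m≤i) = ∈-class⁺ w y
        (EndsAt⇒∈-factors w (w ⟦ suc m , j ⟧) (⟦⟧-EndsAt (ℕ.≤-<-trans m≤i i<j) j≤n))
        (EndsAt⇒∼ y (w ⟦ suc m , j ⟧)
          (λ e → EndsAt-⟦⟧-mono (ℕ.≤⇒≤‴ k≤m) (ℕ.≤-trans m≤i (ℕ.<⇒≤ i<j)) j≤n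
            (∼⇒EndsAt y (w ⟦ suc k , j ⟧) y∼z e))
          (EndsAt-⟦⟧-mono (ℕ.≤⇒≤‴ m≤i) (ℕ.<⇒≤ i<j) j≤n))

  -- Non-initial states and children in the suffix-link tree.

  ∈-nonInitialStates⁺ : ∀ {u} → u ∈ factors w → u ≢ [] → class w u ∈ nonInitialStates w
  ∈-nonInitialStates⁺ {u} u∈ u≢[] = ∈-filter⁺ (λ q → ¬? (q ≟ˢ I w))
    (∈-deduplicate⁺ _≟ˢ_ (∈-map⁺ (class w) u∈))
    (λ eq → ∼-≢[] (class-injective u [] {0} z≤n eq) u≢[] refl)

  -- A representative of a state other than `I` cannot be empty, since the class of the empty word
  -- is `I`.
  nonInitialStates-elim : (Q : State σ → Set) →
    (∀ {u} → u ∈ factors w → u ≢ [] → Q (class w u)) → ∀ {q} → q ∈ nonInitialStates w → Q q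
  nonInitialStates-elim Q f q∈ =
    let q∈states , q≢I = ∈-filter⁻ (λ q → ¬? (q ≟ˢ I w)) {xs = states w} q∈
        u , u∈ , q≡    = ∈-map⁻ (class w) (∈-deduplicate⁻ _≟ˢ_ (map (class w) (factors w)) q∈states)
    in subst Q (sym q≡) (f u∈ λ u≡[] → q≢I (trans q≡ (cong (class w) u≡[])))

  ∈-children⁺ : ∀ {q r} → r ∈ nonInitialStates w → F w r ≡ q → r ∈ children w q
  ∈-children⁺ {q} = ∈-filter⁺ (λ r → F w r ≟ˢ q)

  ∈-children⁻ : ∀ {q r} → r ∈ children w q → r ∈ nonInitialStates w × F w r ≡ q
  ∈-children⁻ {q} = ∈-filter⁻ (λ r → F w r ≟ˢ q) {xs = nonInitialStates w}

  -- Ending positions of states.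

  StateEndsAt : State σ → ℕ → Set
  StateEndsAt q j = ∃[ u ] u ∈ q × EndsAt w u j

  ∈-class-EndsAt : ∀ {u v j} → v ∈ class w u → EndsAt w v j → EndsAt w u j
  ∈-class-EndsAt {u} {v} v∈ = ∼⇒EndsAt v u (sym (proj₂ (∈-class⁻ w u v∈)))

  StateEndsAt-class⁺ : ∀ {u j} → EndsAt w u j → StateEndsAt (class w u) j
  StateEndsAt-class⁺ {u} e = u , ∈-class⁺ w u (EndsAt⇒∈-factors w u e) refl , e

  pos≤length : ∀ (p : Fin (length w)) → pos p ≤ length w
  pos≤length p = Fin.toℕ<n p

  StateEndsAt-T : ∀ (p : Fin (length w)) → StateEndsAt (T w (pos p)) (pos p)
  StateEndsAt-T p = StateEndsAt-class⁺ (⟦⟧-EndsAt (s≤s z≤n) (pos≤length p))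

  -- The suffix link is the class of a suffix of some member of `q`, and a suffix ends wherever the
  -- whole word does.
  StateEndsAt-F : ∀ {q j} → q ∈ nonInitialStates w → StateEndsAt q j → StateEndsAt (F w q) j
  StateEndsAt-F {j = j} = nonInitialStates-elim (λ q → StateEndsAt q j → StateEndsAt (F w q) j)
    λ {u} _ _ (v , v∈q , e) →
      let x , x∈q , Fq≡ = F-class (class w u) v∈q
          x-ends        = ∼⇒EndsAt u x (proj₂ (∈-class⁻ w u x∈q)) (∈-class-EndsAt {u} v∈q e)
      in subst (λ q → StateEndsAt q j) (sym Fq≡) (StateEndsAt-class⁺
           (longestSuffixOutside-elim w (λ s → EndsAt w s j) (class w u) x
             -- The last argument serves the default value of the search: the empty word ends at
             -- every position up to the length of `w`.
             (All.map (λ f _ → f j x-ends) (EndsAt-tails w x)) (EndsAt-bound w v e)))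

  PrefixOrChild : State σ → ℕ → Set
  PrefixOrChild q j = (Σ[ p ∈ Fin (length w) ] pos p ≡ j × T w (pos p) ≡ q) ⊎ (∃[ r ] r ∈ children w q × StateEndsAt r j)

  -- Induction on the starting position, extending the factor to the left by one letter at a time
  -- with `j` fixed.
  prefix-or-child-⟦⟧ : ∀ i {j} → i < j → j ≤ length w →
    PrefixOrChild (class w (w ⟦ suc i , j ⟧)) j
  prefix-or-child-⟦⟧ zero {suc j} i<j j<n = inj₁ (fromℕ< j<n , pos≡ , cong (T w) pos≡)
    where
    pos≡ : pos (fromℕ< j<n) ≡ suc j
    pos≡ = cong suc (Fin.toℕ-fromℕ< j<n)
  prefix-or-child-⟦⟧ (suc i) {j} i<j j≤n =
    extend (_∼?_ w (w ⟦ suc i , j ⟧) (w ⟦ suc (suc i) , j ⟧))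
    where
    e : EndsAt w (w ⟦ suc i , j ⟧) j
    e = ⟦⟧-EndsAt (ℕ.<⇒≤ i<j) j≤n
    extend : Dec (_∼_ w (w ⟦ suc i , j ⟧) (w ⟦ suc (suc i) , j ⟧)) →
      PrefixOrChild (class w (w ⟦ suc (suc i) , j ⟧)) j
    -- The longer word lies in the same state, so the induction hypothesis speaks of this state.
    extend (yes eq) = subst (λ q → PrefixOrChild q j) (class-cong (w ⟦ suc i , j ⟧) (w ⟦ suc (suc i) , j ⟧) eq)
      (prefix-or-child-⟦⟧ i (ℕ.<⇒≤ i<j) j≤n)
    extend (no ≁)   = inj₂ (class w (w ⟦ suc i , j ⟧)
      , ∈-children⁺ (∈-nonInitialStates⁺ (EndsAt⇒∈-factors w _ e) (⟦⟧-≢[] (ℕ.<⇒≤ i<j) j≤n))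
                    (F-⟦⟧ (ℕ.<⇒≤ i<j) j≤n ≁)
      , StateEndsAt-class⁺ e)

  prefix-or-child : ∀ {q j} → q ∈ nonInitialStates w → StateEndsAt q j → PrefixOrChild q j
  prefix-or-child {j = j} = nonInitialStates-elim (λ q → StateEndsAt q j → PrefixOrChild q j)
    λ {u} _ u≢[] (v , v∈q , e) → from-occurrence (EndsAt⇒Occurrence u≢[] (∈-class-EndsAt {u} v∈q e))
    where
    from-occurrence : ∀ {u} → (∃[ i ] Occurrence w u i j) → PrefixOrChild (class w u) j
    from-occurrence (suc i , _ , i<j , j≤n , refl) = prefix-or-child-⟦⟧ i i<j j≤n

  -- Prefix states are distinct.

  -- A word ending at `k` has length at most `k`, and this prefix has length `suc j`.
  T-EndsAt-≤ : ∀ {j k} → suc j ≤ length w → EndsAt w (w ⟦ 1 , suc j ⟧) k → suc j ≤ k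
  T-EndsAt-≤ {j} {k} j<n e
    with suc i , _ , _ , k≤n , eq ← EndsAt⇒Occurrence (⟦⟧-≢[] (s≤s z≤n) j<n) e =
    subst (_≤ k) (trans (sym (length-⟦⟧ i k≤n)) (trans (cong length (sym eq)) (length-⟦⟧ 0 j<n)))
      (ℕ.m∸n≤m k i)

  -- The position is recovered from the state as its least ending position. Hence the scan never
  -- overwrites the entry of an earlier prefix.
  T-pos-injective : ∀ {p p′ : Fin (length w)} → T w (pos p) ≡ T w (pos p′) → p ≡ p′
  T-pos-injective {p} {p′} eq = Fin.toℕ-injective (ℕ.suc-injective (ℕ.≤-antisym
    (T-EndsAt-≤ (pos≤length p) (∼⇒EndsAt (prefix p′) (prefix p) (sym p∼p′) (ends p′)))
    (T-EndsAt-≤ (pos≤length p′) (∼⇒EndsAt (prefix p) (prefix p′) p∼p′ (ends p)))))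
    where
    prefix : Fin (length w) → Word σ
    prefix p = w ⟦ 1 , pos p ⟧
    ends : ∀ p → EndsAt w (prefix p) (pos p)
    ends p = ⟦⟧-EndsAt (s≤s z≤n) (pos≤length p)
    p∼p′ : _∼_ w (prefix p) (prefix p′)
    p∼p′ = class-injective (prefix p) (prefix p′) (ends p′) eq

  T-∈-nonInitialStates : ∀ (p : Fin (length w)) → T w (pos p) ∈ nonInitialStates w
  T-∈-nonInitialStates p = ∈-nonInitialStates⁺
    (EndsAt⇒∈-factors w _ (⟦⟧-EndsAt (s≤s z≤n) (pos≤length p))) (⟦⟧-≢[] (s≤s z≤n) (pos≤length p))

-- Distances back to `P` and the left-to-right scan.

module _ {σ : ℕ} (w : Word σ) (P : Subset (length w)) where

  -- The bound `m` on the scanned positions is kept apart from the position `j` from which the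
  -- distance is measured, because the scan reuses one `k` for many `j`.
  NearUpTo : ℕ → ℕ → ℕ → Set
  NearUpTo m j L = ∃[ t ] t ∈ˢ P × pos t ≤ m × j ∸ pos t < L

  -- Near j L: every factor of length ≥ L ending at j contains a position of P.
  Near : ℕ → ℕ → Set
  Near j = NearUpTo j j

  -- Expresses that the minimum distance back to `P` over the ending positions of `q` is below `L`,
  -- without forming the minimum.
  Reaches : State σ → ℕ → Set
  Reaches q L = ∃[ j ] StateEndsAt w q j × Near j L

  -- Holds after positions 1 to `m`. The field `last` pins down `k` by the distances it yields from
  -- every `j`.
  record ScanInvariant (m : ℕ) (k : ℕ ₋) (d : Table σ) : Set where
    field
      last     : ∀ {j L} → j ⊖ k ≺ L ⇔ NearUpTo m j L
      sound    : ∀ {q L} → d q ≺ L → Σ[ p ∈ Fin (length w) ] T w (pos p) ≡ q × Near (pos p) L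
      complete : ∀ {p : Fin (length w)} {L} → pos p ≤ m → Near (pos p) L → d (T w (pos p)) ≺ L

  -- If the current position is in `P`, it is the latest so far and gives the least distance;
  -- otherwise members of `P` up to it lie strictly before it.
  lastPosition-≺ : ∀ {k j L} p → (j ⊖ k ≺ L ⇔ NearUpTo (toℕ p) j L) →
    (j ⊖ lastPosition w P k p ≺ L ⇔ NearUpTo (pos p) j L)
  lastPosition-≺ {j = j} p last with p ∈ˢ? P
  ... | yes p∈P = mk⇔ (λ h → p , p∈P , ℕ.≤-refl , h)
                      (λ (t , _ , t≤p , h) → ℕ.≤-<-trans (ℕ.∸-monoʳ-≤ j t≤p) h)
  ... | no  p∉P = mk⇔ (λ h → let t , t∈P , t≤p , h′ = to last h in t , t∈P , ℕ.m≤n⇒m≤1+n t≤p , h′)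
                      (λ (t , t∈P , t≤p , h) → from last (t , t∈P , strict t∈P t≤p , h))
    where
    strict : ∀ {t} → t ∈ˢ P → pos t ≤ pos p → pos t ≤ toℕ p
    strict t∈P (s≤s t≤p) = ℕ.≤∧≢⇒< t≤p
      λ t≡p → p∉P (subst (_∈ˢ P) (Fin.toℕ-injective t≡p) t∈P)

  scanStep-invariant : ∀ {m k d} p → toℕ p ≡ m → ScanInvariant m k d →
    let k′ , d′ = scanStep w P (k , d) p in ScanInvariant (suc m) k′ d′
  scanStep-invariant {k = k} {d} p refl inv = record
    { last = last′ ; sound = sound′ ; complete = complete′ }
    where
    open ScanInvariant inv
    v : ℕ∞
    v = pos p ⊖ lastPosition w P k p
    last′ : ∀ {j L} → j ⊖ lastPosition w P k p ≺ L ⇔ NearUpTo (pos p) j L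
    last′ = lastPosition-≺ p last
    sound′ : ∀ {q L} → (d ⟦ T w (pos p) ≔ v ⟧) q ≺ L → Σ[ p ∈ Fin (length w) ] T w (pos p) ≡ q × Near (pos p) L
    sound′ {q} h with q ≟ˢ T w (pos p)
    ... | yes refl = p , refl , to last′ h
    ... | no  _    = sound h
    complete′ : ∀ {p′ : Fin (length w)} {L} → pos p′ ≤ pos p → Near (pos p′) L →
      (d ⟦ T w (pos p) ≔ v ⟧) (T w (pos p′)) ≺ L
    complete′ {p′} {L} p′≤p near with T w (pos p′) ≟ˢ T w (pos p)
    -- By injectivity of the prefix states, the entry just written belongs to `p′` only if `p′` is
    -- `p`.
    ... | yes eq with refl ← T-pos-injective w {p′} {p} eq = from last′ near
    ... | no  ≢T = complete (ℕ.≤-pred (ℕ.≤∧≢⇒< p′≤p (≢T ∘ cong (T w)))) near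

  -- Generalised from `allFin` to any run of consecutive positions starting after `m`, so that the
  -- induction applies to the tail.
  foldl-scanStep-invariant : ∀ {n m k d} (f : Fin n → Fin (length w)) →
    (∀ i → toℕ (f i) ≡ m + toℕ i) → ScanInvariant m k d →
    let k′ , d′ = foldl (scanStep w P) (k , d) (tabulate f) in ScanInvariant (m + n) k′ d′
  foldl-scanStep-invariant {zero}  {m} f eq inv =
    subst (λ m → ScanInvariant m _ _) (sym (ℕ.+-identityʳ m)) inv
  foldl-scanStep-invariant {suc n} {m} {k} {d} f eq inv =
    subst (λ m → ScanInvariant m k′ d′) (sym (ℕ.+-suc m n))
      (foldl-scanStep-invariant (f ∘ suc) (λ i → trans (eq (suc i)) (ℕ.+-suc m (toℕ i)))
        (scanStep-invariant (f zero) (trans (eq zero) (ℕ.+-identityʳ m)) inv))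
    where
    result = foldl (scanStep w P) (k , d) (tabulate f)
    k′ = proj₁ result
    d′ = proj₂ result

  scan-invariant : ∃[ k ] ScanInvariant (length w) k (scan w P)
  scan-invariant = _ , foldl-scanStep-invariant {m = 0} id (λ _ → refl) record
    { last     = mk⇔ (λ ()) (λ ())
    ; sound    = λ ()
    ; complete = λ ()
    }

  -- The bottom-up traversal.

  -- Here `qs` holds the states still to be visited. Visited entries are exact; the others are sound
  -- and must keep what the scan stored for prefixes.
  record TraverseInvariant (qs : List (State σ)) (d : Table σ) : Set where
    field
      sound    : ∀ {q L} → q ∈ nonInitialStates w → d q ≺ L → Reaches q L
      prefixes : ∀ {p : Fin (length w)} {L} → Near (pos p) L → d (T w (pos p)) ≺ L
      complete : ∀ {q L} → q ∈ nonInitialStates w → q ∉ qs → Reaches q L → d q ≺ L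

  scan-traverseInvariant : ∀ {qs} → (∀ {q} → q ∈ nonInitialStates w → q ∈ qs) →
    TraverseInvariant qs (scan w P)
  scan-traverseInvariant ⊆qs = record
    { sound    = λ _ h → let p , T≡q , near = sound h in
                   pos p , subst (λ q → StateEndsAt w q (pos p)) T≡q (StateEndsAt-T w p) , near
    ; prefixes = λ {p} → complete (pos≤length w p)
    ; complete = λ q∈ q∉qs _ → ⊥-elim (q∉qs (⊆qs q∈))
    }
    where open ScanInvariant (proj₂ scan-invariant)

  -- The traversal order keeps children of `q` out of `qs`, and no state is its own child because a
  -- suffix link has strictly more ending positions.
  childrenVisited : ∀ {q r qs} → All (λ r → F w r ≢ q) qs → r ∈ children w q → r ∉ q ∷ qs
  childrenVisited {q} {r} F≢q r∈ = λ
    { (here r≡q)   → ℕ.<⇒≢ (size-F w (proj₁ r-child)) (cong (size w) (trans r≡q (sym (proj₂ r-child))))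
    ; (there r∈qs) → All.lookup F≢q r∈qs (proj₂ r-child)
    }
    where
    r-child : r ∈ nonInitialStates w × F w r ≡ q
    r-child = ∈-children⁻ w {q} r∈

  -- All children already carry exact values. Their ending positions belong to `q`, and any further
  -- one comes from a prefix, recorded in `d q` itself.
  minOverChildren-≺ : ∀ {q qs d L} → q ∈ nonInitialStates w → All (λ r → F w r ≢ q) qs →
    TraverseInvariant (q ∷ qs) d → minOverChildren w d q ≺ L ⇔ Reaches q L
  minOverChildren-≺ {q} {qs} {d} {L} q∈ F≢q inv = mk⇔ to′ from′
    where
    open TraverseInvariant inv
    to′ : minOverChildren w d q ≺ L → Reaches q L
    to′ h = [ sound q∈ , reaches-child ∘ find ∘ Any.map⁻ ]′
      (foldr-⊓∞-≺⁻ (d q) (map d (children w q)) h)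
      where
      reaches-child : ∃[ r ] r ∈ children w q × d r ≺ L → Reaches q L
      reaches-child (r , r∈ , dr≺L) =
        let r∈′ , Fr≡q      = ∈-children⁻ w {q} r∈
            j , ends , near = sound r∈′ dr≺L
        in j , subst (λ q → StateEndsAt w q j) Fr≡q (StateEndsAt-F w r∈′ ends) , near
    from′ : Reaches q L → minOverChildren w d q ≺ L
    from′ (j , ends , near) = foldr-⊓∞-≺⁺ (d q) (map d (children w q))
      ([ inj₁ ∘ prefix near
       , (λ (r , r∈ , ends′) → inj₂ (Any.map⁺ (lose r∈
           (complete (proj₁ (∈-children⁻ w {q} r∈)) (childrenVisited F≢q r∈) (j , ends′ , near)))))
       ]′ (prefix-or-child w q∈ ends))
      where
      prefix : ∀ {j} → Near j L → (Σ[ p ∈ Fin (length w) ] pos p ≡ j × T w (pos p) ≡ q) → d q ≺ L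
      prefix near (p , refl , T≡q) = subst (λ q → d q ≺ L) T≡q (prefixes near)

  visit-invariant : ∀ {q qs d} → q ∈ nonInitialStates w → All (λ r → F w r ≢ q) qs →
    TraverseInvariant (q ∷ qs) d → TraverseInvariant qs (d ⟦ q ≔ minOverChildren w d q ⟧)
  visit-invariant {q} {qs} {d} q∈ F≢q inv = record
    { sound = sound′ ; prefixes = prefixes′ ; complete = complete′ }
    where
    open TraverseInvariant inv
    v : ℕ∞
    v = minOverChildren w d q
    v-≺ : ∀ {L} → v ≺ L ⇔ Reaches q L
    v-≺ = minOverChildren-≺ q∈ F≢q inv
    sound′ : ∀ {r L} → r ∈ nonInitialStates w → (d ⟦ q ≔ v ⟧) r ≺ L → Reaches r L
    sound′ {r} r∈ h with r ≟ˢ q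
    ... | yes refl = to v-≺ h
    ... | no  _    = sound r∈ h
    prefixes′ : ∀ {p : Fin (length w)} {L} → Near (pos p) L → (d ⟦ q ≔ v ⟧) (T w (pos p)) ≺ L
    prefixes′ {p} near with T w (pos p) ≟ˢ q
    -- Overwriting loses nothing: `pos p` is among the ending positions that the new value accounts
    -- for.
    ... | yes refl = from v-≺ (pos p , StateEndsAt-T w p , near)
    ... | no  _    = prefixes near
    complete′ : ∀ {r L} → r ∈ nonInitialStates w → r ∉ qs → Reaches r L → (d ⟦ q ≔ v ⟧) r ≺ L
    complete′ {r} r∈ r∉qs h with r ≟ˢ q
    ... | yes refl = from v-≺ h
    ... | no  r≢q  = complete r∈ (λ { (here r≡q) → r≢q r≡q ; (there r∈qs) → r∉qs r∈qs }) h

  -- The value tested at `q` is already final, so passing the test amounts to `Reaches q (ℓ q)`.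
  traverse-true : ∀ {qs d} → All (_∈ nonInitialStates w) qs → AllPairs (λ q r → F w r ≢ q) qs →
    TraverseInvariant qs d → traverse w qs d ≡ true ⇔ All (λ q → Reaches q (ℓ q)) qs
  traverse-true []         []           inv = mk⇔ (λ _ → []) (λ _ → refl)
  traverse-true {q ∷ qs} {d} (q∈ ∷ qs∈) (F≢q ∷ F≢qs) inv
    with ≤⁺-dec _≤?_ [ ℓ q ] (minOverChildren w d q)
  ... | yes ℓ≤v = mk⇔ (λ ()) λ { (h ∷ _) →
        ⊥-elim (≺⇒≰⁺ _ (from (minOverChildren-≺ q∈ F≢q inv) h) ℓ≤v) }
  ... | no  ℓ≰v = mk⇔
        (λ h → to (minOverChildren-≺ q∈ F≢q inv) (≰⁺⇒≺ _ ℓ≰v) ∷ to rest h)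
        (λ { (_ ∷ hs) → from rest hs })
    where rest = traverse-true qs∈ F≢qs (visit-invariant q∈ F≢q inv)

  -- Covering in terms of distances.

  Near-mono : ∀ {j L L′} → L ≤ L′ → Near j L → Near j L′
  Near-mono L≤L′ (t , t∈P , t≤j , h) = t , t∈P , t≤j , ℕ.<-≤-trans h L≤L′

  length-Occurrence : ∀ {u i j} → Occurrence w u (suc i) j → length u ≡ j ∸ i
  length-Occurrence {i = i} (_ , _ , j≤n , refl) = length-⟦⟧ w i j≤n

  -- An occurrence from `suc i` to `j` has length `j ∸ i`; for `pos t ≤ j`, starting no later than
  -- `pos t` means `j ∸ pos t < j ∸ i`.
  Covers⇔Near : ∀ {u} → u ≢ [] → Covers w u P ⇔ (∃[ j ] EndsAt w u j × Near j (length u))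
  Covers⇔Near {u} u≢[] = mk⇔ to′ from′
    where
    to′ : Covers w u P → ∃[ j ] EndsAt w u j × Near j (length u)
    to′ (suc i , j , o , t , t∈P , s≤s i≤t , t<j) = j , Occurrence⇒EndsAt w u o , t , t∈P , t<j ,
      subst (j ∸ pos t <_) (sym (length-Occurrence o)) (ℕ.∸-monoʳ-< (s≤s i≤t) t<j)
    from′ : ∃[ j ] EndsAt w u j × Near j (length u) → Covers w u P
    from′ (j , e , t , t∈P , t≤j , h) with suc i , o ← EndsAt⇒Occurrence w u≢[] e =
      suc i , j , o , t , t∈P , ℕ.≰⇒> (λ t≤i → ℕ.<⇒≱ (subst (j ∸ pos t <_) (length-Occurrence o) h)
        (ℕ.∸-monoʳ-≤ j t≤i)) , t≤j

  IsFactor⇒∈-factors : ∀ {u} → u ≢ [] → IsFactor w u → u ∈ factors w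
  IsFactor⇒∈-factors {[]}    u≢[] _ = ⊥-elim (u≢[] refl)
  IsFactor⇒∈-factors {_ ∷ _} _    (suc i , j , _ , j≤n , eq) =
    -- `IsFactor` leaves the order of the endpoints open; non-emptiness forces `suc i ≤ j`.
    EndsAt⇒∈-factors w _ (suc i , s≤s z≤n , ℕ.m∸n≢0⇒n<m (take≢[] w (j ∸ i) (drop i w) eq) , j≤n , eq)

  ∈-factors⇒IsFactor : ∀ {u} → u ≢ [] → u ∈ factors w → IsFactor w u
  ∈-factors⇒IsFactor u≢[] u∈
    with j , e ← ∈-factors⇒EndsAt w u∈
    with i , 1≤i , _ , j≤n , eq ← EndsAt⇒Occurrence w u≢[] e = i , j , 1≤i , j≤n , eq

  -- Forward, coverage is applied to a shortest member of the state; backward, every member is at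
  -- least that long and has the same ending positions.
  attractor⇔reaches : IsWordAttractor w P ⇔ (∀ {q} → q ∈ nonInitialStates w → Reaches q (ℓ q))
  attractor⇔reaches = mk⇔ to′ from′
    where
    to′ : IsWordAttractor w P → ∀ {q} → q ∈ nonInitialStates w → Reaches q (ℓ q)
    to′ attractor = nonInitialStates-elim w (λ q → Reaches q (ℓ q)) λ {u} u∈ u≢[] →
      let v , v∈q , |v|≡ℓ = ℓ-attained (class w u) (∈-class⁺ w u u∈ refl)
          v∈ , u∼v        = ∈-class⁻ w u v∈q
          v≢[]            = ∼-≢[] w u∼v u≢[]
          j , e , near    = to (Covers⇔Near v≢[]) (attractor v (∈-factors⇒IsFactor v≢[] v∈) v≢[])
      in j , (v , v∈q , e) , subst (Near j) |v|≡ℓ near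
    from′ : (∀ {q} → q ∈ nonInitialStates w → Reaches q (ℓ q)) → IsWordAttractor w P
    from′ reaches u factor u≢[] =
      let u∈                       = IsFactor⇒∈-factors u≢[] factor
          j , (v , v∈q , e) , near = reaches (∈-nonInitialStates⁺ w u∈ u≢[])
      in from (Covers⇔Near u≢[]) (j , ∈-class-EndsAt w {u} v∈q e
           , Near-mono (ℓ-≤ (class w u) (∈-class⁺ w u u∈ refl)) near)

proposition3 : ∀ {σ : ℕ} (w : Word σ) (P : Subset (length w)) (qs : List (State σ)) →
    IsBottomUpTraversal w qs →
    IsWordAttractor w P ⇔ (isAttractor w P qs ≡ true)
proposition3 w P qs (qs↭ , childrenFirst) = mk⇔
  (λ attractor → from returnsTrue
    (All.tabulate (λ q∈ → to (attractor⇔reaches w P) attractor (∈-resp-↭ qs↭ q∈))))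
  (λ h → from (attractor⇔reaches w P) (λ q∈ → All.lookup (to returnsTrue h) (∈-resp-↭ (↭-sym qs↭) q∈)))
  where
  returnsTrue : isAttractor w P qs ≡ true ⇔ All (λ q → Reaches w P q (ℓ q)) qs
  -- Being a permutation, `qs` has only non-initial states and misses none, so initially no state
  -- counts as visited.
  returnsTrue = traverse-true w P (All.tabulate (∈-resp-↭ qs↭)) childrenFirst
    (scan-traverseInvariant w P (∈-resp-↭ (↭-sym qs↭)))
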